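{- Let $E$ be a finite set, let $\mathbb{G}$ be a finite $\mathsf{E}$-group and let $N\geq 2$. Then there is a finite $\mathsf{E}$-group $\hat{\mathbb{G}}$ with $\hat{\mathbb{G}}\succeq\mathbb{G}$ such that $\hat{\mathbb{G}}$ is $N$-acyclic and, for every permutation $\rho\in\mathrm{Sym}(E)$, if $\rho$ is a symmetry of $\mathbb{G}$ then $\rho$ is a symmetry of $\hat{\mathbb{G}}$.
   Context: An $\mathsf{E}$-group is a group $\mathbb{G}=(G,\cdot,1)$ that contains $E$ as a set of pairwise distinct non-trivial involutions ($e=e^{ -1}\neq 1$) which generate $\mathbb{G}$. For a word $w=e_1\cdots e_n\in E^*$ write $[w]_{\mathbb{G}}=e_1\cdots e_n\in G$. For $\alpha\subseteq E$, $\mathbb{G}[\alpha]=\{[w]_{\mathbb{G}}: w\in\alpha^*\}$ is the subgroup generated by $\alpha$. A homomorphism of $\mathsf{E}$-groups is a group homomorphism mapping each $e\in E$ to $e$; $\hat{\mathbb{G}}\succeq\mathbb{G}$ means that such a homomorphism $\hat{\mathbb{G}}\to\mathbb{G}$ exists. A coset cycle of length $n\geq 2$ in $\mathbb{G}$ is a cyclically indexed sequence $(g_i\mathbb{G}[\alpha_i],g_i)_{i\in\mathbb{Z}_n}$ with $g_i\in G$, $\alpha_i\subseteq E$, such that for all $i$: (connectivity) $g_{i+1}\in g_i\mathbb{G}[\alpha_i]$, and (separation) $g_i\mathbb{G}[\alpha_i\cap\alpha_{i-1}]\cap g_{i+1}\mathbb{G}[\alpha_i\cap\alpha_{i+1}]=\emptyset$.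 $\mathbb{G}$ is $N$-acyclic if it has no coset cycle of length $n$ with $2\le n\leq N$. A permutation $\rho$ of $E$ is a symmetry of the $\mathsf{E}$-group $\mathbb{G}$ if renaming the generators according to $\rho$ yields an isomorphic $\mathsf{E}$-group, i.e. if there is a group automorphism $\varphi$ of $\mathbb{G}$ with $\varphi(e)=\rho(e)$ for all $e\in E$. -}

module Defs where

open import Level using (0ℓ)
open import Data.Nat using (ℕ; suc; _+_; _∸_; _≤_; NonZero)
open import Data.Nat.DivMod using (_mod_)
open import Data.Fin using (Fin; toℕ)
open import Data.Fin.Subset using (Subset; _∈_; _∩_)
open import Data.Fin.Permutation using (Permutation′; _⟨$⟩ʳ_)
open import Data.List using (List; []; _∷_)
open import Data.List.Relation.Unary.All using (All)
open import Data.Product using (Σ; ∃; _×_)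
open import Relation.Binary.PropositionalEquality using (_≡_)
open import Relation.Nullary using (¬_)
open import Algebra.Bundles using (Group)
open import Algebra.Morphism.Structures using (module GroupMorphisms)

evalWord : {k : ℕ} (G : Group 0ℓ 0ℓ) → (Fin k → Group.Carrier G) → List (Fin k) → Group.Carrier G
evalWord G gen [] = Group.ε G
evalWord G gen (e ∷ w) = Group._∙_ G (gen e) (evalWord G gen w)

-- The finite generator set E is represented as Fin k.
-- An E-group: a group (with setoid equality _≈_) together with an injective
-- labelling of E by non-trivial involutions that generate the group.
record EGroup (k : ℕ) : Set₁ where
  field
    group : Group 0ℓ 0ℓ
  open Group group public
  field
    gen          : Fin k → Carrier
    involution   : ∀ e → gen e ∙ gen e ≈ ε
    nontrivial   : ∀ e → ¬ (gen e ≈ ε)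
    distinct     : ∀ e e′ → gen e ≈ gen e′ → e ≡ e′
    generates    : ∀ g → ∃ λ (w : List (Fin k)) → evalWord group gen w ≈ g
  ⟦_⟧ : List (Fin k) → Carrier
  ⟦_⟧ = evalWord group gen

module _ {k : ℕ} (G : EGroup k) where
  open EGroup G

  IsFinite : Set
  IsFinite = ∃ λ (n : ℕ) → Σ (Fin n → Carrier) λ f → ∀ g → ∃ λ i → f i ≈ g

  InCoset : Carrier → Subset k → Carrier → Set
  InCoset g α x = ∃ λ (w : List (Fin k)) → All (_∈ α) w × x ≈ g ∙ ⟦ w ⟧

next : {n : ℕ} .{{_ : NonZero n}} → Fin n → Fin n
next {n} i = suc (toℕ i) mod n

prev : {n : ℕ} .{{_ : NonZero n}} → Fin n → Fin n
prev {n} i = (toℕ i + (n ∸ 1)) mod n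

module _ {k : ℕ} (G : EGroup k) where
  open EGroup G

  -- a coset cycle of length n: (g_i G[α_i], g_i)_{i ∈ ℤ_n}
  record CosetCycle (n : ℕ) .{{_ : NonZero n}} : Set where
    field
      g : Fin n → Carrier
      α : Fin n → Subset k
      connectivity : ∀ i → InCoset G (g i) (α i) (g (next i))
      separation   : ∀ i → ¬ (∃ λ x → InCoset G (g i) (α i ∩ α (prev i)) x
                                     × InCoset G (g (next i)) (α i ∩ α (next i)) x)

  Acyclic : ℕ → Set
  Acyclic N = ∀ n .{{_ : NonZero n}} → 2 ≤ n → n ≤ N → ¬ CosetCycle n

_⪰_ : {k : ℕ} → EGroup k → EGroup k → Set
Ĝ ⪰ G = Σ (Ĝ.Carrier → G.Carrier) λ φ →
          GroupMorphisms.IsGroupHomomorphism Ĝ.rawGroup G.rawGroup φ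
          × (∀ e → φ (Ĝ.gen e) G.≈ G.gen e)
  where module Ĝ = EGroup Ĝ
        module G = EGroup G

IsSymmetry : {k : ℕ} → Permutation′ k → EGroup k → Set
IsSymmetry ρ G = Σ (G.Carrier → G.Carrier) λ φ →
          GroupMorphisms.IsGroupIsomorphism G.rawGroup G.rawGroup φ
          × (∀ e → φ (G.gen e) G.≈ G.gen (ρ ⟨$⟩ʳ e))
  where module G = EGroup G

{-# OPTIONS --safe #-}

-- The group is built on words as a tower of k = |E| refinements of the word problem of G. Step j
-- adds the action on every bounded permutation graph that satisfies all relations between at most
-- j generators, so that subgroups with at most j generators no longer change, while everything
-- else becomes as free as the bound permits.
-- A coset cycle may be assumed to use proper subsets of E, since separation fails next to E itself.
-- Glue its cosets into a chain, each to the next, leaving the ends apart; letters that are not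
-- available at a vertex act as loops. By induction on the number of generators the chain satisfies
-- the relations of the group: within a subgroup with j generators a component of the chain either
-- is a single coset of that subgroup or is itself a chain of cosets of smaller subgroups. But the
-- label of the cycle, a relation, leads from the first coset of the chain to the last one.
-- Chains of length one give retractions onto subgroups, hence that cosets intersect in cosets.
-- Equality in G need not be decidable; as acyclicity is a negative statement, decidability may be
-- assumed in its proof.
module Submission where

open import Defs
open import Level using (0ℓ)
open import Algebra.Bundles using (Group)
open import Algebra.Morphism.Structures using (module GroupMorphisms)
open import Data.Bool using (Bool; true; false; T)
open import Data.Empty using (⊥; ⊥-elim)
open import Data.Fin as Fin using (Fin; toℕ; fromℕ<; combine; funToFin; finToFun)
import Data.Fin.Properties as Fin
open import Data.Fin.Permutation using (Permutation′; _⟨$⟩ʳ_; _⟨$⟩ˡ_; inverseˡ; inverseʳ)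
import Data.Fin.Subset as S
import Data.Fin.Subset.Properties as S
open import Data.List
  using (List; []; _∷_; [_]; _++_; _∷ʳ_; length; map; reverse; filter; lookup; take; drop; allFin; concatMap)
open import Data.List.Membership.DecPropositional using () renaming (_∈?_ to member?)
open import Data.List.Membership.Propositional using (_∈_; lose)
open import Data.List.Membership.Propositional.Properties using (∈-map⁺; ∈-concatMap⁺; ∈-allFin; ∈-filter⁺)
open import Data.List.Properties
open import Data.List.Relation.Unary.All as All using (All; []; _∷_)
import Data.List.Relation.Unary.All.Properties as All
open import Data.List.Relation.Unary.Any as Any using (here; there)
import Data.List.Relation.Unary.Any.Properties as Any
open import Data.Nat
  using (ℕ; zero; suc; _+_; _*_; _∸_; _^_; _≤_; _<_; _≤′_; ≤′-refl; ≤′-step; z≤n; s≤s; NonZero; _%_)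
open import Data.Nat.DivMod using (_mod_; m%n<n; %-distribˡ-+; m%n%n≡m%n; [m+n]%n≡m%n)
open import Data.Nat.Induction using (<-wellFounded)
open import Data.Nat.Properties
open import Data.Product using (Σ; ∃; ∃₂; _×_; _,_; proj₁; proj₂)
open import Data.Sum using (_⊎_; inj₁; inj₂)
open import Data.Unit using (⊤; tt)
open import Function using (_∘_; id)
open import Induction.WellFounded using (Acc; acc)
open import Relation.Binary.Core using (Rel)
open import Relation.Binary.Definitions using (Decidable)
open import Relation.Binary.PropositionalEquality
  using (_≡_; refl; sym; trans; cong; cong₂; subst; _≗_; module ≡-Reasoning)
open import Relation.Binary.Structures using (IsEquivalence)
open import Relation.Nullary using (¬_; Dec; yes; no; contradiction)
open import Relation.Nullary.Decidable
  using (⌊_⌋; toWitness; fromWitness; decidable-stable; ¬¬-excluded-middle; _×-dec_; _⊎-dec_)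
open import Relation.Unary as U using (Pred; _∩_)

-- Words, and congruences of finite index on them

Word : ℕ → Set
Word k = List (Fin k)

All-reverse : ∀ {A : Set} {P : A → Set} {xs} → All P xs → All P (reverse xs)
All-reverse [] = []
All-reverse {P = P} {x ∷ xs} (px ∷ pxs) =
  subst (All P) (sym (unfold-reverse x xs)) (All.++⁺ (All-reverse pxs) (px ∷ []))

-- A finite group generated by elements of square one, given by its word problem. `class` may give
-- several names to one element, so that finiteness does not presuppose a decision procedure for
-- `_~_`.
record WordCongruence (k : ℕ) : Set₁ where
  infix 4 _~_
  field
    _~_           : Rel (Word k) 0ℓ
    isEquivalence : IsEquivalence _~_
    ++-cong       : ∀ {u u′ v v′} → u ~ u′ → v ~ v′ → u ++ v ~ u′ ++ v′
    cancel        : ∀ e → e ∷ e ∷ [] ~ []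
    index         : ℕ
    class         : Word k → Fin index
    class-reflects : ∀ {u v} → class u ≡ class v → u ~ v

  open IsEquivalence isEquivalence public
    renaming (refl to ~-refl; sym to ~-sym; trans to ~-trans; reflexive to ~-reflexive)

  ++-congˡ : ∀ w {u v} → u ~ v → w ++ u ~ w ++ v
  ++-congˡ w = ++-cong (~-refl {w})

  ++-congʳ : ∀ w {u v} → u ~ v → u ++ w ~ v ++ w
  ++-congʳ w u~v = ++-cong u~v (~-refl {w})

  inverseʳ~ : ∀ w → w ++ reverse w ~ []
  inverseʳ~ [] = ~-refl
  inverseʳ~ (e ∷ w) = ~-trans (~-reflexive eq)
    (~-trans (++-congˡ [ e ] (++-congʳ [ e ] (inverseʳ~ w))) (cancel e))
    where
    eq : e ∷ w ++ reverse (e ∷ w) ≡ [ e ] ++ ((w ++ reverse w) ++ [ e ])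
    eq = cong (e ∷_) (trans (cong (w ++_) (unfold-reverse e w)) (sym (++-assoc w _ _)))

  inverseˡ~ : ∀ w → reverse w ++ w ~ []
  inverseˡ~ w = subst (λ v → reverse w ++ v ~ []) (reverse-involutive w) (inverseʳ~ (reverse w))

  cancelʳ : ∀ u w → (u ++ w) ++ reverse w ~ u
  cancelʳ u w = ~-trans (~-reflexive (++-assoc u w _))
    (~-trans (++-congˡ u (inverseʳ~ w)) (~-reflexive (++-identityʳ u)))

  cancelˡ : ∀ w u → reverse w ++ (w ++ u) ~ u
  cancelˡ w u = ~-trans (~-reflexive (sym (++-assoc (reverse w) w u))) (++-congʳ u (inverseˡ~ w))

  cancelˡ′ : ∀ w u → w ++ (reverse w ++ u) ~ u
  cancelˡ′ w u = ~-trans (~-reflexive (sym (++-assoc w (reverse w) u))) (++-congʳ u (inverseʳ~ w))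

  ~-cancelˡ : ∀ w {u v} → w ++ u ~ w ++ v → u ~ v
  ~-cancelˡ w {u} {v} p =
    ~-trans (~-sym (cancelˡ w u)) (~-trans (++-congˡ (reverse w) p) (cancelˡ w v))

  reverse-cong : ∀ {u v} → u ~ v → reverse u ~ reverse v
  reverse-cong {u} {v} u~v = ~-cancelˡ u
    (~-trans (inverseʳ~ u) (~-trans (~-sym (inverseʳ~ v)) (++-congʳ (reverse v) (~-sym u~v))))

  quotientGroup : Group 0ℓ 0ℓ
  quotientGroup = record
    { Carrier = Word k ; _≈_ = _~_ ; _∙_ = _++_ ; ε = [] ; _⁻¹ = reverse
    ; isGroup = record
      { isMonoid = record
        { isSemigroup = record
          { isMagma = record { isEquivalence = isEquivalence ; ∙-cong = ++-cong }
          ; assoc = λ u v w → ~-reflexive (++-assoc u v w) }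
        ; identity = (λ _ → ~-refl) , λ w → ~-reflexive (++-identityʳ w) }
      ; inverse = inverseˡ~ , inverseʳ~
      ; ⁻¹-cong = reverse-cong } }

  evalWord-letters : ∀ w → evalWord quotientGroup [_] w ≡ w
  evalWord-letters [] = refl
  evalWord-letters (e ∷ w) = cong (e ∷_) (evalWord-letters w)

  shorten : ∀ w → index < length w → ∃ λ w′ → length w′ < length w × w ~ w′
  shorten w long with Fin.pigeonhole long (λ i → class (take (toℕ i) w))
  ... | i , j , i<j , eq = take (toℕ i) w ++ drop (toℕ j) w , shorter , w~
    where
    j≤ : toℕ j ≤ length w
    j≤ = <⇒≤ (Fin.toℕ<n j)
    shorter : length (take (toℕ i) w ++ drop (toℕ j) w) < length w
    shorter = subst (_< length w) (sym (trans (length-++ (take (toℕ i) w))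
        (cong₂ _+_ (trans (length-take (toℕ i) w) (m≤n⇒m⊓n≡m (≤-trans (<⇒≤ i<j) j≤)))
                   (length-drop (toℕ j) w))))
      (subst (toℕ i + (length w ∸ toℕ j) <_) (m+[n∸m]≡n j≤) (+-monoˡ-< (length w ∸ toℕ j) i<j))
    w~ : w ~ take (toℕ i) w ++ drop (toℕ j) w
    w~ = ~-trans (~-reflexive (sym (take++drop≡id (toℕ j) w)))
           (++-congʳ (drop (toℕ j) w) (~-sym (class-reflects eq)))

  short-representative : ∀ w → ∃ λ w′ → length w′ ≤ index × w ~ w′
  short-representative w = go w (<-wellFounded _)
    where
    go : ∀ w → Acc _<_ (length w) → ∃ λ w′ → length w′ ≤ index × w ~ w′
    go w (acc rs) with length w ≤? index
    ... | yes short = w , short , ~-refl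
    ... | no  long with shorten w (≰⇒> long)
    ... | w′ , lt , eq with go w′ (rs lt)
    ... | w″ , le , eq′ = w″ , le , ~-trans eq eq′

_⊢_~_ : ∀ {k} → WordCongruence k → Rel (Word k) 0ℓ
_⊢_~_ = WordCongruence._~_

_⊨_≈_ : ∀ {k} → EGroup k → Rel (Word k) 0ℓ
G ⊨ u ≈ v = ⟦ u ⟧ ≈ ⟦ v ⟧
  where open EGroup G

wordsUpTo : ∀ {k} → ℕ → List (Word k)
wordsUpTo zero = [ [] ]
wordsUpTo {k} (suc n) = [] ∷ concatMap (λ e → map (e ∷_) (wordsUpTo n)) (allFin k)

∈-wordsUpTo : ∀ {k n} (w : Word k) → length w ≤ n → w ∈ wordsUpTo n
∈-wordsUpTo {n = zero} [] _ = here refl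
∈-wordsUpTo {n = suc n} [] _ = here refl
∈-wordsUpTo {k} {suc n} (e ∷ w) (s≤s le) =
  there (∈-concatMap⁺ (λ e → map (e ∷_) (wordsUpTo n))
          (lose (∈-allFin e) (∈-map⁺ (e ∷_) (∈-wordsUpTo w le))))

-- Actions of words on finite sets

act : ∀ {k} {A : Set} → (Fin k → A → A) → Word k → A → A
act σ [] p = p
act σ (e ∷ w) p = act σ w (σ e p)

act-++ : ∀ {k} {A : Set} (σ : Fin k → A → A) u v p → act σ (u ++ v) p ≡ act σ v (act σ u p)
act-++ σ [] v p = refl
act-++ σ (e ∷ u) v p = act-++ σ u v (σ e p)

act-ext : ∀ {k} {A : Set} {σ τ : Fin k → A → A} → (∀ e → σ e ≗ τ e) → ∀ w → act σ w ≗ act τ w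
act-ext σ≗τ [] p = refl
act-ext {τ = τ} σ≗τ (e ∷ w) p = trans (act-ext σ≗τ w _) (cong (act τ w) (σ≗τ e p))

act-map : ∀ {k l} {A : Set} (σ : Fin l → A → A) (f : Fin k → Fin l) w → act σ (map f w) ≗ act (σ ∘ f) w
act-map σ f [] p = refl
act-map σ f (e ∷ w) p = act-map σ f w (σ (f e) p)

-- The points are the classes of R, which saves choosing canonical representatives.
record FiniteAction (k b : ℕ) : Set where
  field
    σ          : Fin k → Fin b → Fin b
    R          : Fin b → Fin b → Bool
    R-equiv    : IsEquivalence (λ p q → T (R p q))
    σ-cong     : ∀ e {p q} → T (R p q) → T (R (σ e p) (σ e q))
    σ-involutive : ∀ e p → T (R (σ e (σ e p)) p)

  _≈_ : Rel (Fin b) 0ℓ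
  p ≈ q = T (R p q)

  act-cong : ∀ w {p q} → p ≈ q → act σ w p ≈ act σ w q
  act-cong [] r = r
  act-cong (e ∷ w) r = act-cong w (σ-cong e r)

relabel : ∀ {k b} → (Fin k → Fin k) → FiniteAction k b → FiniteAction k b
relabel f X = record
  { σ = σ ∘ f ; R = R ; R-equiv = R-equiv ; σ-cong = σ-cong ∘ f ; σ-involutive = σ-involutive ∘ f }
  where open FiniteAction X

Agree : ∀ {k b} → FiniteAction k b → Rel (Word k) 0ℓ
Agree X u v = ∀ p → act σ u p ≈ act σ v p
  where open FiniteAction X

Obeys : ∀ {k b} → Rel (Word k) 0ℓ → FiniteAction k b → Set
Obeys _~_ X = ∀ {u v} → u ~ v → Agree X u v

agree-relabel : ∀ {k b} (f : Fin k → Fin k) (X : FiniteAction k b) u v →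
  Agree X (map f u) (map f v) → Agree (relabel f X) u v
agree-relabel f X u v agree p = subst T (cong₂ R (act-map σ f u p) (act-map σ f v p)) (agree p)
  where open FiniteAction X

agree-unlabel : ∀ {k b} (f : Fin k → Fin k) (X : FiniteAction k b) u v →
  Agree (relabel f X) u v → Agree X (map f u) (map f v)
agree-unlabel f X u v agree p = subst T (sym (cong₂ R (act-map σ f u p) (act-map σ f v p))) (agree p)
  where open FiniteAction X

-- Relations between few generators, and the refinement step

record Small {k} (j : ℕ) (_~_ : Rel (Word k) 0ℓ) (u v : Word k) : Set where
  constructor small
  field
    {letters} : List (Fin k)
    size      : length letters ≤ j
    inˡ       : All (_∈ letters) u
    inʳ       : All (_∈ letters) v
    related   : u ~ v

Small-map : ∀ {k j} {_~_ _~′_ : Rel (Word k) 0ℓ} →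
  (∀ {u v} → Small j _~_ u v → u ~′ v) → ∀ {u v} → Small j _~_ u v → Small j _~′_ u v
Small-map f s@(small le bu bv _) = small le bu bv (f s)

-- Relations of C between at most j generators survive, others only if they hold in every b-point
-- action of the former.
module Refinement {k} (C : WordCongruence k) (j b : ℕ) where
  open WordCongruence C

  _≋_ : Rel (Word k) 0ℓ
  u ≋ v = u ~ v × (∀ (X : FiniteAction k b) → Obeys (Small j _~_) X → Agree X u v)

  -- Codes for all families of k self-maps of the b points, including those that are no actions.
  -- Recording the effect of a word under each of them keeps the index finite.
  Table : ℕ
  Table = (b ^ b) ^ k

  decode : Fin Table → Fin k → Fin b → Fin b
  decode t e = finToFun (finToFun t e)

  encode : (Fin k → Fin b → Fin b) → Fin Table
  encode σ = funToFin (funToFin ∘ σ)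

  decode-encode : ∀ σ e → decode (encode σ) e ≗ σ e
  decode-encode σ e p = trans (cong (λ x → finToFun x p) (Fin.finToFun-funToFin (funToFin ∘ σ) e))
    (Fin.finToFun-funToFin (σ e) p)

  actionTable : Word k → Fin ((b ^ b) ^ Table)
  actionTable w = funToFin (λ t → funToFin (act (decode t) w))

  actionTable-reflects : ∀ {u v} → actionTable u ≡ actionTable v → ∀ σ → act σ u ≗ act σ v
  actionTable-reflects {u} {v} eq σ p =
    trans (sym (same u)) (trans (cong (λ x → finToFun (finToFun x (encode σ)) p) eq) (same v))
    where
    same : ∀ w → finToFun (finToFun (actionTable w) (encode σ)) p ≡ act σ w p
    same w = trans
      (cong (λ x → finToFun x p) (Fin.finToFun-funToFin (λ t → funToFin (act (decode t) w)) (encode σ)))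
      (trans (Fin.finToFun-funToFin (act (decode (encode σ)) w) p) (act-ext (decode-encode σ) w p))

  ≋-++ : ∀ {u u′ v v′} → u ≋ u′ → v ≋ v′ → (u ++ v) ≋ (u′ ++ v′)
  ≋-++ {u} {u′} {v} {v′} (r , s) (r′ , s′) = ++-cong r r′ , agree
    where
    agree : ∀ X → Obeys (Small j _~_) X → Agree X (u ++ v) (u′ ++ v′)
    agree X obeys p = trans′ (reflexive′ (act-++ σ u v p)) (trans′ (act-cong v (s X obeys p))
      (trans′ (s′ X obeys (act σ u′ p)) (reflexive′ (sym (act-++ σ u′ v′ p)))))
      where
      open FiniteAction X
      open IsEquivalence R-equiv renaming (trans to trans′; reflexive to reflexive′) using ()

  refinement : WordCongruence k
  refinement = record
    { _~_ = _≋_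
    ; isEquivalence = record
      { refl = ~-refl , λ X _ p → IsEquivalence.refl (R-equiv X)
      ; sym = λ (r , s) → ~-sym r , λ X o p → IsEquivalence.sym (R-equiv X) (s X o p)
      ; trans = λ (r , s) (r′ , s′) → ~-trans r r′ ,
          λ X o p → IsEquivalence.trans (R-equiv X) (s X o p) (s′ X o p) }
    ; ++-cong = ≋-++
    ; cancel = λ e → cancel e , λ X _ p → σ-involutive X e p
    ; index = index * (b ^ b) ^ Table
    ; class = λ w → combine (class w) (actionTable w)
    ; class-reflects = λ {u} {v} eq →
        let eq₁ , eq₂ = Fin.combine-injective (class u) (actionTable u) (class v) (actionTable v) eq in
        class-reflects eq₁ , λ X _ p →
          IsEquivalence.reflexive (R-equiv X) (actionTable-reflects {u} {v} eq₂ (FiniteAction.σ X) p) }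
    where
    open FiniteAction using (R-equiv; σ-involutive)

  small-≋ : ∀ {u v} → Small j _~_ u v → u ≋ v
  small-≋ s = Small.related s , λ X o p → o s p

  -- Renaming does not increase the number of letters, so relabelling an admissible action by f
  -- yields an admissible action, on which the given relation can be tested.
  map-≋ : ∀ (f : Fin k → Fin k) → (∀ {u v} → u ~ v → map f u ~ map f v) →
          ∀ {u v} → u ≋ v → map f u ≋ map f v
  map-≋ f f~ {u} {v} (r , s) = f~ r , λ X obeys → agree-unlabel f X u v (s (relabel f X)
    λ {u} {v} (small {letters} le bu bv r) → agree-relabel f X u v
      (obeys (small (≤-trans (≤-reflexive (length-map f letters)) le) (im bu) (im bv) (f~ r))))
    where
    im : ∀ {b w} → All (_∈ b) w → All (_∈ map f b) (map f w)
    im = All.map⁺ ∘ All.map (∈-map⁺ f)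

-- The E-group presented by a congruence

module _ {k} (G : EGroup k) where
  private
    module G = EGroup G

  eval-++ : ∀ u v → G.⟦ u ++ v ⟧ G.≈ G.⟦ u ⟧ G.∙ G.⟦ v ⟧
  eval-++ [] v = G.sym (G.identityˡ _)
  eval-++ (e ∷ u) v = G.trans (G.∙-congˡ (eval-++ u v)) (G.sym (G.assoc _ _ _))

map-inverse : ∀ {A B : Set} {f : B → A} {g : A → B} → (∀ x → f (g x) ≡ x) → ∀ xs → map f (map g xs) ≡ xs
map-inverse fg xs = trans (sym (map-∘ xs)) (trans (map-cong fg xs) (map-id xs))

-- The generators stay non-trivial and distinct because they are so after mapping to G.
module Presented {k} (G : EGroup k) (C : WordCongruence k)
  (toG : ∀ u v → C ⊢ u ~ v → G ⊨ u ≈ v) where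

  open WordCongruence C

  private
    module G = EGroup G

  eval-[] : ∀ e → G.⟦ [ e ] ⟧ G.≈ G.gen e
  eval-[] e = G.identityʳ _

  presented : EGroup k
  presented = record
    { group = quotientGroup
    ; gen = [_]
    ; involution = cancel
    ; nontrivial = λ e p → G.nontrivial e (G.trans (G.sym (eval-[] e)) (toG [ e ] [] p))
    ; distinct = λ e e′ p → G.distinct e e′ (G.trans (G.sym (eval-[] e)) (G.trans (toG [ e ] [ e′ ] p) (eval-[] e′)))
    ; generates = λ w → w , ~-reflexive (evalWord-letters w) }

  presented-finite : IsFinite presented
  presented-finite = length ws , lookup ws , λ w →
    let w′ , le , eq = short-representative w ; mem = ∈-wordsUpTo w′ le in
    Any.index mem , ~-sym (~-trans eq (~-reflexive (Any.lookup-index mem)))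
    where
    ws : List (Word k)
    ws = wordsUpTo index

  eval-⁻¹ : ∀ w → G.⟦ reverse w ⟧ G.≈ G.⟦ w ⟧ G.⁻¹
  eval-⁻¹ w = G.uniqueˡ-⁻¹ _ _ (G.trans (G.sym (eval-++ G (reverse w) w)) (toG (reverse w ++ w) [] (inverseˡ~ w)))

  presented-⪰ : presented ⪰ G
  presented-⪰ = G.⟦_⟧ , record
    { isMonoidHomomorphism = record
      { isMagmaHomomorphism = record
        { isRelHomomorphism = record { cong = λ {u} {v} → toG u v } ; homo = eval-++ G }
      ; ε-homo = G.refl }
    ; ⁻¹-homo = eval-⁻¹ } , eval-[]

  presented-symmetry : (ρ : Permutation′ k) →
    (∀ {u v} → u ~ v → map (ρ ⟨$⟩ʳ_) u ~ map (ρ ⟨$⟩ʳ_) v) →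
    (∀ {u v} → u ~ v → map (ρ ⟨$⟩ˡ_) u ~ map (ρ ⟨$⟩ˡ_) v) → IsSymmetry ρ presented
  presented-symmetry ρ ρ~ ρ⁻¹~ = map (ρ ⟨$⟩ʳ_) , record
    { isGroupMonomorphism = record
      { isGroupHomomorphism = record
        { isMonoidHomomorphism = record
          { isMagmaHomomorphism = record
            { isRelHomomorphism = record { cong = ρ~ }
            ; homo = λ u v → ~-reflexive (map-++ (ρ ⟨$⟩ʳ_) u v) }
          ; ε-homo = ~-refl }
        ; ⁻¹-homo = λ w → ~-reflexive (reverse-map (ρ ⟨$⟩ʳ_) w) }
      ; injective = λ {u} {v} p → ~-trans (~-reflexive (sym (map-inverse (λ _ → inverseˡ ρ) u)))
          (~-trans (ρ⁻¹~ p) (~-reflexive (map-inverse (λ _ → inverseˡ ρ) v))) }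
    ; surjective = λ w → map (ρ ⟨$⟩ˡ_) w , λ p →
        ~-trans (ρ~ p) (~-reflexive (map-inverse (λ _ → inverseʳ ρ) w)) }
    , λ e → ~-refl

-- The tower of refinements and its saturation

module Tower {k} (C : WordCongruence k) (N : ℕ) where

  tower : ℕ → WordCongruence k
  tower zero = C
  -- Subgroups with at most j generators are final at level j, so its index bounds their size; the
  -- points suffice for N cosets of them.
  tower (suc j) = Refinement.refinement (tower j) j (N * WordCongruence.index (tower j))

  _~[_]_ : Word k → ℕ → Word k → Set
  u ~[ j ] v = WordCongruence._~_ (tower j) u v

  coarsen : ∀ {i j u v} → i ≤′ j → u ~[ j ] v → u ~[ i ] v
  coarsen ≤′-refl r = r
  coarsen (≤′-step le) r = coarsen le (proj₁ r)

  -- Each refinement from level i upwards protects the relations between at least i, hence at least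
  -- l, letters.
  refine-small : ∀ {l i j u v} → l ≤ i → i ≤′ j → Small l _~[ i ]_ u v → u ~[ j ] v
  refine-small l≤i ≤′-refl s = Small.related s
  refine-small {j = suc j} l≤i (≤′-step i≤j) s@(small le bu bv _) =
    Refinement.small-≋ (tower j) j _
      (small (≤-trans le (≤-trans l≤i (≤′⇒≤ i≤j))) bu bv (refine-small l≤i i≤j s))

  -- The construction singles out no generator; this is how symmetries pass up the tower.
  tower-map : ∀ (f : Fin k → Fin k) → (∀ {u v} → u ~[ 0 ] v → map f u ~[ 0 ] map f v) →
    ∀ j {u v} → u ~[ j ] v → map f u ~[ j ] map f v
  tower-map f f~ zero = f~
  tower-map f f~ (suc j) = Refinement.map-≋ (tower j) j _ f (tower-map f f~ j)

-- The bound N * width on the number of points refers to chains of at most N cosets,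
-- each with at most width elements.
record SaturatedAt {k} (C : WordCongruence k) (N j : ℕ) : Set where
  open WordCongruence C
  field
    width    : ℕ
    name     : Word k → Fin width
    name-reflects : ∀ {u v} → Small j (λ u v → name u ≡ name v) u v → u ~ v
    saturated : (X : FiniteAction k (N * width)) → Obeys (Small j _~_) X → Obeys _~_ X

-- Level j and the top level have the same relations between at most j letters, and the step from j
-- to j + 1 has tested every action on this number of points.
tower-saturated : ∀ {k} (C : WordCongruence k) N j → j < k → SaturatedAt (Tower.tower C N k) N j
tower-saturated {k} C N j j<k = record
  { width = index
  ; name = class
  ; name-reflects = λ (small le bu bv eq) → refine-small ≤-refl j≤k (small le bu bv (class-reflects eq))
  ; saturated = λ X obeys r →
      proj₂ (coarsen (≤⇒≤′ j<k) r) X (λ s → obeys (Small-map (refine-small ≤-refl j≤k) s)) }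
  where
  open Tower C N
  open WordCongruence (tower j)
  j≤k : j ≤′ k
  j≤k = ≤⇒≤′ (<⇒≤ j<k)

-- Excluded middle for finitely many statements, and actions from right congruences

¬¬-Π : ∀ {n} {P : Fin n → Set} → (∀ i → ¬ ¬ P i) → ¬ ¬ (∀ i → P i)
¬¬-Π {zero} _ ¬p = ¬p λ ()
¬¬-Π {suc n} ps ¬p = ps Fin.zero λ p₀ → ¬¬-Π (ps ∘ Fin.suc) λ ps′ →
  ¬p λ { Fin.zero → p₀ ; (Fin.suc i) → ps′ i }

filter-∩ : ∀ {A : Set} {P Q : Pred A 0ℓ} (P? : U.Decidable P) (Q? : U.Decidable Q) {xs} →
  All Q xs → filter (λ x → P? x ×-dec Q? x) xs ≡ filter P? xs
filter-∩ P? Q? [] = refl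
filter-∩ P? Q? {x ∷ xs} (q ∷ qs) with P? x | Q? x
... | no _  | _     = filter-∩ P? Q? qs
... | yes _ | yes _ = cong (x ∷_) (filter-∩ P? Q? qs)
... | yes _ | no ¬q = contradiction q ¬q

-- A right congruence on words is realised by a finite action on its classes.
module _ {k N j} {C : WordCongruence k} (sat : SaturatedAt C N j)
  {_≈_ : Rel (Word k) 0ℓ} (≈-equiv : IsEquivalence _≈_) (_≈?_ : Decidable _≈_)
  (≈-∷ʳ : ∀ e {u v} → u ≈ v → (u ∷ʳ e) ≈ (v ∷ʳ e))
  (≈-cancel : ∀ e u → ((u ∷ʳ e) ∷ʳ e) ≈ u)
  (word : Fin (N * SaturatedAt.width sat) → Word k) (point : ∀ w → ∃ λ p → word p ≈ w)
  (obeys : ∀ w {u v} → Small j (C ⊢_~_) u v → (w ++ u) ≈ (w ++ v)) where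

  open WordCongruence C
  open SaturatedAt sat

  private
    module E = IsEquivalence ≈-equiv

    X : FiniteAction k (N * width)
    X = record
      { σ = λ e p → proj₁ (point (word p ∷ʳ e))
      ; R = λ p q → ⌊ word p ≈? word q ⌋
      ; R-equiv = record
        { refl = fromWitness E.refl
        ; sym = λ r → fromWitness (E.sym (toWitness r))
        ; trans = λ r s → fromWitness (E.trans (toWitness r) (toWitness s)) }
      ; σ-cong = λ e r → fromWitness (E.trans (proj₂ (point _))
          (E.trans (≈-∷ʳ e (toWitness r)) (E.sym (proj₂ (point _)))))
      ; σ-involutive = λ e p → fromWitness (E.trans (proj₂ (point _))
          (E.trans (≈-∷ʳ e (proj₂ (point _))) (≈-cancel e _))) }

    open FiniteAction X using (σ)

    ≈-++ : ∀ w {u v} → u ≈ v → (u ++ w) ≈ (v ++ w)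
    ≈-++ [] {u} {v} r = E.trans (E.reflexive (++-identityʳ u)) (E.trans r (E.reflexive (sym (++-identityʳ v))))
    ≈-++ (e ∷ w) {u} {v} r = E.trans (E.reflexive (sym (∷ʳ-++ u e w)))
      (E.trans (≈-++ w (≈-∷ʳ e r)) (E.reflexive (∷ʳ-++ v e w)))

    word-act : ∀ w p → word (act σ w p) ≈ (word p ++ w)
    word-act [] p = E.reflexive (sym (++-identityʳ (word p)))
    word-act (e ∷ w) p = E.trans (word-act w _)
      (E.trans (≈-++ w (proj₂ (point _))) (E.reflexive (∷ʳ-++ (word p) e w)))

    X-obeys : Obeys (Small j _~_) X
    X-obeys s p = fromWitness (E.trans (word-act _ p)
      (E.trans (obeys (word p) s) (E.sym (word-act _ p))))

  -- The relation is tested at the point of the empty word, from which u and v lead to their own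
  -- classes.
  ~⇒right-congruence : ∀ {u v} → u ~ v → u ≈ v
  ~⇒right-congruence {u} {v} r =
    E.trans (start u) (E.trans (toWitness (saturated X X-obeys r o)) (E.sym (start v)))
    where
    o : Fin (N * width)
    o = proj₁ (point [])
    start : ∀ w → w ≈ word (act σ w o)
    start w = E.sym (E.trans (word-act w o) (≈-++ w (proj₂ (point []))))

-- Graphs glued from cosets satisfy the relations of the group

-- The Cayley graph-like structures glued from at most N cosets: At s i h says that the vertex s
-- is the element h of the i-th coset. By thin, a component for the letters in β meets each of the
-- cosets in at most one coset of a smaller subgroup, which bounds the size of the component.
record CosetGraph {k} (C : WordCongruence k) (N : ℕ) : Set₁ where
  open WordCongruence C
  infix 4 _≈_
  field
    State   : Set
    _≈_     : Rel State 0ℓ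
    ≈-equiv : IsEquivalence _≈_
    _≈?_    : Decidable _≈_
    step    : Fin k → State → State
    step-cong : ∀ e {s t} → s ≈ t → step e s ≈ step e t
    step-involutive : ∀ e s → step e (step e s) ≈ s
    piece   : ℕ → Pred (Fin k) 0ℓ
    piece?  : ∀ i → U.Decidable (piece i)
    At      : State → ℕ → Word k → Set
    at-bound : ∀ {s i h} → At s i h → i < N
    at-exists : ∀ s → ∃₂ λ i h → At s i h
    at-resp : ∀ {s t i h} → s ≈ t → At s i h → At t i h
    at-unique : ∀ {s t i h h′} → At s i h → At t i h′ → h ~ h′ → s ≈ t
    at-step : ∀ {s i h e} → At s i h → piece i e → At (step e s) i (h ∷ʳ e)
    thin    : ∀ {β : Pred (Fin k) 0ℓ} {w s i h h′} → All β w → At s i h → At (act step w s) i h′ →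
              ∃ λ x → All (piece i ∩ β) x × h′ ~ h ++ x

  open IsEquivalence ≈-equiv public
    renaming (refl to ≈-refl; sym to ≈-sym; trans to ≈-trans; reflexive to ≈-reflexive)

  run : Word k → State → State
  run = act step

  run-cong : ∀ w {s t} → s ≈ t → run w s ≈ run w t
  run-cong [] r = r
  run-cong (e ∷ w) r = run-cong w (step-cong e r)

  run-reverse : ∀ w s → run (reverse w) (run w s) ≈ s
  run-reverse [] s = ≈-refl
  run-reverse (e ∷ w) s = ≈-trans
    (≈-reflexive (trans (cong (λ x → run x (run w (step e s))) (unfold-reverse e w))
      (act-++ step (reverse w) [ e ] (run w (step e s)))))
    (≈-trans (step-cong e (run-reverse w (step e s))) (step-involutive e s))

  at-run : ∀ {w s i h} → At s i h → All (piece i) w → At (run w s) i (h ++ w)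
  at-run {[]} {s} {i} {h} a [] = subst (At s i) (sym (++-identityʳ h)) a
  at-run {e ∷ w} {s} {i} {h} a (pe ∷ pw) =
    subst (At (run w (step e s)) i) (∷ʳ-++ h e w) (at-run (at-step a pe) pw)

Fewer : ∀ {k} → ℕ → Pred (Fin k) 0ℓ → Set
Fewer j P = ∃ λ b → length b < j × (∀ {e} → P e → e ∈ b)

fewer-∩ : ∀ {k j} {P Q : Pred (Fin k) 0ℓ} → Fewer j P → Fewer j (P ∩ Q)
fewer-∩ (b , lt , cover) = b , lt , cover ∘ proj₁

module _ {k N} {C : WordCongruence k} (Y : CosetGraph C N)
  (sat : ∀ j → j < k → SaturatedAt C N j) where

  open WordCongruence C
  open CosetGraph Y

  -- Induction on j. Having the same endpoint from s, with letters outside β dropped, is a right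
  -- congruence on words. Its classes are few enough for saturation, as each is given by a coset and
  -- an element of a subgroup with few generators. This leaves the relations between few letters,
  -- where the induction hypothesis applies.
  relations-hold : ∀ j → j ≤ k → {β : Pred (Fin k) 0ℓ} (β? : U.Decidable β) (s : State) →
    (∀ {w i h} → All β w → At (run w s) i h → Fewer j (piece i ∩ β)) →
    ∀ {u v} → u ~ v → run (filter β? u) s ≈ run (filter β? v) s
  relations-hold zero _ β? s visited _ with at-exists s
  ... | i , h , a with visited [] a
  ... | _ , () , _
  relations-hold (suc j) j<k {β} β? s visited {u₀} {v₀} u₀~v₀ = decidable-stable (go u₀ ≈? go v₀) λ ¬goal →
    -- The goal is decidable, so it may be taken as known which cosets the component meets and which
    -- codes occur in it.
    ¬¬-Π (λ i → ¬¬-excluded-middle {A = ∃₂ λ w h → At (go w) (toℕ i) h}) λ bases →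
    ¬¬-Π (λ c → ¬¬-excluded-middle {A = ∃ λ w → code bases w ≡ c}) λ words →
    ¬goal (~⇒right-congruence (sat j j<k) {_≈_ = λ w w′ → go w ≈ go w′}
      (record { refl = ≈-refl ; sym = ≈-sym ; trans = ≈-trans })
      (λ w w′ → go w ≈? go w′)
      (λ e {w} {w′} r → ≈-trans (≈-reflexive (go-++ w [ e ]))
        (≈-trans (run-cong (filter β? [ e ]) r) (≈-reflexive (sym (go-++ w′ [ e ])))))
      go-cancel
      (λ c → word bases c (words c))
      (λ w → code bases w , decoded bases w (words (code bases w)))
      (λ w {u} {v} r → ≈-trans (≈-reflexive (go-++ w u))
        (≈-trans (small-relation w r) (≈-reflexive (sym (go-++ w v)))))
      u₀~v₀)
    where
    open SaturatedAt (sat j j<k)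

    go : Word k → State
    go w = run (filter β? w) s

    go-++ : ∀ w v → go (w ++ v) ≡ run (filter β? v) (go w)
    go-++ w v = trans (cong (λ x → run x s) (filter-++ β? w v)) (act-++ step (filter β? w) _ s)

    go-cancel : ∀ e w → go ((w ∷ʳ e) ∷ʳ e) ≈ go w
    go-cancel e w =
      ≈-trans (≈-reflexive (trans (cong go (++-assoc w [ e ] [ e ])) (go-++ w (e ∷ e ∷ [])))) twice
      where
      twice : run (filter β? (e ∷ e ∷ [])) (go w) ≈ go w
      twice with β? e in eq
      ... | no _ rewrite eq = ≈-refl
      ... | yes _ rewrite eq = step-involutive e (go w)

    Base : Fin N → Set
    Base i = Dec (∃₂ λ w h → At (go w) (toℕ i) h)

    base : ∀ {i} → Base i → Word k
    base (yes (_ , h , _)) = h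
    -- A dummy value for a coset that the component does not meet.
    base (no _) = []

    -- Going back along w₀ to s and on along w is a β-path between two vertices of the i-th coset,
    -- so `thin` applies.
    offset : ∀ {i} (b : Base i) w {h} → At (go w) (toℕ i) h →
      ∃ λ x → All (piece (toℕ i) ∩ β) x × h ~ base b ++ x
    offset (no ¬a) w a = ⊥-elim (¬a (w , _ , a))
    offset (yes (w₀ , h₀ , a₀)) w a =
      thin {w = reverse (filter β? w₀) ++ filter β? w}
        (All.++⁺ (All-reverse (All.all-filter β? w₀)) (All.all-filter β? w)) a₀ (at-resp (≈-sym back) a)
      where
      back : run (reverse (filter β? w₀) ++ filter β? w) (go w₀) ≈ go w
      back = ≈-trans (≈-reflexive (act-++ step (reverse (filter β? w₀)) _ (go w₀)))
        (run-cong (filter β? w) (run-reverse (filter β? w₀) s))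

    Position : Word k → Set
    Position w = ∃₂ λ (i : Fin N) h → At (go w) (toℕ i) h

    position : ∀ w → Position w
    position w with at-exists (go w)
    ... | i , h , a = fromℕ< (at-bound a) , h ,
      subst (λ i → At (go w) i h) (sym (Fin.toℕ-fromℕ< (at-bound a))) a

    label : (∀ i → Base i) → ∀ w → Position w → Fin width
    label bases w (i , h , a) = name (proj₁ (offset (bases i) w a))

    code : (∀ i → Base i) → Word k → Fin (N * width)
    code bases w = combine (proj₁ (position w)) (label bases w (position w))

    label-reflects : ∀ bases {w w′} (p : Position w) (q : Position w′) →
      proj₁ p ≡ proj₁ q → label bases w p ≡ label bases w′ q → go w ≈ go w′
    label-reflects bases {w} {w′} (i , h , a) (.i , h′ , a′) refl eq =
      at-unique a a′ (~-trans h~ (~-trans (++-congˡ (base (bases i)) x~x′) (~-sym h′~)))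
      where
      x  = proj₁ (offset (bases i) w a)
      x′ = proj₁ (offset (bases i) w′ a′)
      h~  = proj₂ (proj₂ (offset (bases i) w a))
      h′~ = proj₂ (proj₂ (offset (bases i) w′ a′))
      x~x′ : x ~ x′
      x~x′ with visited (All.all-filter β? w) a
      ... | b , s≤s le , cover = name-reflects (small le
        (All.map cover (proj₁ (proj₂ (offset (bases i) w a))))
        (All.map cover (proj₁ (proj₂ (offset (bases i) w′ a′)))) eq)

    word : ∀ bases c → Dec (∃ λ w → code bases w ≡ c) → Word k
    word _ _ (yes (w , _)) = w
    word _ _ (no _) = []

    decoded : ∀ bases w (d : Dec (∃ λ w′ → code bases w′ ≡ code bases w)) → go (word bases (code bases w) d) ≈ go w
    decoded bases w (no ¬p) = ⊥-elim (¬p (w , refl))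
    decoded bases w (yes (w′ , eq)) =
      let eq₁ , eq₂ = Fin.combine-injective
            (proj₁ (position w′)) (label bases w′ (position w′))
            (proj₁ (position w)) (label bases w (position w)) eq
      in label-reflects bases (position w′) (position w) eq₁ eq₂

    -- Only letters in b matter, so β shrinks to its part in b. Either every visited coset lacks one
    -- of the letters of b, and the induction hypothesis applies, or the relation holds inside a
    -- single coset.
    small-relation : ∀ w {u v} → Small j _~_ u v → run (filter β? u) (go w) ≈ run (filter β? v) (go w)
    small-relation w {u} {v} (small {b} le bu bv u~v) = decidable-stable (_ ≈? _) λ ¬goal →
      ¬goal (≈-trans (≈-reflexive (restrict bu)) (≈-trans
        (relations-hold j (<⇒≤ j<k) βb? (go w) (λ all a → fewer ¬goal all a) u~v)
        (≈-reflexive (sym (restrict bv)))))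
      where
      βb? : U.Decidable (β ∩ (_∈ b))
      βb? e = β? e ×-dec member? Fin._≟_ e b

      restrict : ∀ {x} → All (_∈ b) x → run (filter β? x) (go w) ≡ run (filter βb? x) (go w)
      restrict bx = cong (λ x → run x (go w)) (sym (filter-∩ β? (λ e → member? Fin._≟_ e b) bx))

      -- Once a path with letters in b meets a coset having all letters of b as generators,
      -- it never leaves that coset.
      fewer : ¬ (run (filter β? u) (go w) ≈ run (filter β? v) (go w)) →
        ∀ {x i h} → All (β ∩ (_∈ b)) x → At (run x (go w)) i h → Fewer j (piece i ∩ (β ∩ (_∈ b)))
      fewer ¬goal {x} {i} {h} all a with All.all? (λ e → piece? i e ×-dec β? e) b
      ... | no ¬all = filter inside? b
                    , <-≤-trans (filter-notAll inside? b (All.¬All⇒Any¬ inside? b ¬all)) le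
                    , λ (pe , βe , eb) → ∈-filter⁺ inside? eb (pe , βe)
        where
        inside? : U.Decidable (piece i ∩ β)
        inside? e = piece? i e ×-dec β? e
      ... | yes inside = ⊥-elim (¬goal (at-unique (arrive bu) (arrive bv) (++-congˡ (h ++ reverse x) u~v)))
        where
        -- Reading x backwards inside the coset shows that the starting vertex lies in it.
        a₀ : At (go w) i (h ++ reverse x)
        a₀ = at-resp (run-reverse x (go w))
          (at-run a (All-reverse (All.map (λ (_ , eb) → proj₁ (All.lookup inside eb)) all)))
        arrive : ∀ {y} → All (_∈ b) y → At (run (filter β? y) (go w)) i ((h ++ reverse x) ++ y)
        arrive {y} by = subst (λ z → At (run z (go w)) i ((h ++ reverse x) ++ y))
          (sym (filter-all β? (All.map (proj₂ ∘ All.lookup inside) by)))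
          (at-run a₀ (All.map (proj₁ ∘ All.lookup inside) by))

-- Chains of cosets

Coset : ∀ {k} → WordCongruence k → Pred (Fin k) 0ℓ → Rel (Word k) 0ℓ
Coset C P q w = ∃ λ x → All P x × w ~ q ++ x
  where open WordCongruence C

-- The free amalgam of n consecutive cosets: the i-th and the (i+1)-st are identified along the
-- set D i, and an edge label that is not available at a vertex acts there as a loop.
module Chain {k N} (C : WordCongruence k) (_~?_ : Decidable (C ⊢_~_))
  {n} (n≤N : n ≤ N)
  (α : ℕ → Pred (Fin k) 0ℓ) (α? : ∀ i → U.Decidable (α i))
  (D : ℕ → Word k → Set) (D? : ∀ i → U.Decidable (D i))
  (D-resp : ∀ {i u v} → C ⊢ u ~ v → D i u → D i v)
  (D-step : ∀ {i u e} → D i u → α i e → α (suc i) e → D i (u ∷ʳ e))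
  (D-coset : ∀ {i u v} {P : Pred (Fin k) 0ℓ} → D i u → D i v →
             Coset C P u v → Coset C (P ∩ (α i ∩ α (suc i))) u v)
  (D-disjoint : ∀ {i u} → D i u → ¬ D (suc i) u)
  where

  open WordCongruence C

  -- The bounds end the gluing at the last coset, so the chain does not close up.
  Link : ℕ → ℕ → Word k → Set
  Link i j h = (j ≡ suc i × j < n × D i h) ⊎ (i ≡ suc j × i < n × D j h)

  Same : ℕ → ℕ → Word k → Set
  Same i j h = i ≡ j ⊎ Link i j h

  same? : ∀ i j h → Dec (Same i j h)
  same? i j h = (i ≟ j) ⊎-dec
    (((j ≟ suc i) ×-dec ((j <? n) ×-dec D? i h)) ⊎-dec ((i ≟ suc j) ×-dec ((i <? n) ×-dec D? j h)))

  same-sym : ∀ {i j h} → Same i j h → Same j i h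
  same-sym (inj₁ refl)     = inj₁ refl
  same-sym (inj₂ (inj₁ l)) = inj₂ (inj₂ l)
  same-sym (inj₂ (inj₂ l)) = inj₂ (inj₁ l)

  -- By `D-disjoint` no element is glued on both sides of its coset, so two gluings in the same
  -- direction never compose.
  same-trans : ∀ {i j l h} → Same i j h → Same j l h → Same i l h
  same-trans (inj₁ refl) s = s
  same-trans s (inj₁ refl) = s
  same-trans (inj₂ (inj₁ (refl , _ , d))) (inj₂ (inj₁ (refl , _ , d′))) = ⊥-elim (D-disjoint d d′)
  same-trans (inj₂ (inj₁ (refl , _))) (inj₂ (inj₂ (refl , _))) = inj₁ refl
  same-trans (inj₂ (inj₂ (refl , _))) (inj₂ (inj₁ (refl , _))) = inj₁ refl
  same-trans (inj₂ (inj₂ (refl , _ , d))) (inj₂ (inj₂ (refl , _ , d′))) = ⊥-elim (D-disjoint d′ d)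

  same-resp : ∀ {i j h h′} → h ~ h′ → Same i j h → Same i j h′
  same-resp r (inj₁ eq) = inj₁ eq
  same-resp r (inj₂ (inj₁ (eq , lt , d))) = inj₂ (inj₁ (eq , lt , D-resp r d))
  same-resp r (inj₂ (inj₂ (eq , lt , d))) = inj₂ (inj₂ (eq , lt , D-resp r d))

  same-step : ∀ {i j h e} → α i e → α j e → Same i j h → Same i j (h ∷ʳ e)
  same-step ai aj (inj₁ eq) = inj₁ eq
  same-step ai aj (inj₂ (inj₁ (refl , lt , d))) = inj₂ (inj₁ (refl , lt , D-step d ai aj))
  same-step ai aj (inj₂ (inj₂ (refl , lt , d))) = inj₂ (inj₂ (refl , lt , D-step d aj ai))

  same-bound : ∀ {i j h} → i < n → Same i j h → j < n
  same-bound lt (inj₁ refl) = lt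
  same-bound lt (inj₂ (inj₁ (_ , lt′ , _))) = lt′
  same-bound lt (inj₂ (inj₂ (refl , _))) = <⇒≤ lt

  State : Set
  State = Fin n × Word k

  At : State → ℕ → Word k → Set
  At (i , h) j h′ = h ~ h′ × Same (toℕ i) j h

  _≈_ : Rel State 0ℓ
  s ≈ (j , h) = At s (toℕ j) h

  ≈-refl : ∀ {s} → s ≈ s
  ≈-refl = ~-refl , inj₁ refl

  ≈-sym : ∀ {s t} → s ≈ t → t ≈ s
  ≈-sym (r , s) = ~-sym r , same-sym (same-resp r s)

  at-resp : ∀ {s t i h} → s ≈ t → At s i h → At t i h
  at-resp (r , s) (r′ , s′) = ~-trans (~-sym r) r′ , same-resp r (same-trans (same-sym s) s′)

  ≈-trans : ∀ {s t u} → s ≈ t → t ≈ u → s ≈ u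
  ≈-trans st tu = at-resp (≈-sym st) tu

  at-unique : ∀ {s t i h h′} → At s i h → At t i h′ → h ~ h′ → s ≈ t
  at-unique (r , s) (r′ , s′) h~h′ =
    ~-trans r (~-trans h~h′ (~-sym r′)) ,
    same-trans s (same-sym (same-resp (~-trans r′ (~-trans (~-sym h~h′) (~-sym r))) s′))

  -- A vertex may lie in two cosets; a letter is available if either has it as a generator.
  Move : Fin k → State → Set
  Move e (i , h) = ∃ λ (j : Fin n) → Same (toℕ i) (toℕ j) h × α (toℕ j) e

  move? : ∀ e s → Dec (Move e s)
  move? e (i , h) = Fin.any? λ j → same? (toℕ i) (toℕ j) h ×-dec α? (toℕ j) e

  step : Fin k → State → State
  step e (i , h) with move? e (i , h)
  ... | yes (j , _) = j , h ∷ʳ e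
  ... | no _        = i , h

  step-fixed : ∀ {e s} → ¬ Move e s → step e s ≡ s
  step-fixed {e} {s} ¬m with move? e s
  ... | yes m = ⊥-elim (¬m m)
  ... | no _  = refl

  at⇒move : ∀ {e s i h} → At s i h → α i e → Move e s
  at⇒move {e} {s = i₀ , h₀} (_ , same) αe = fromℕ< i<n ,
    subst (λ i → Same (toℕ i₀) i h₀) (sym eq) same , subst (λ i → α i e) (sym eq) αe
    where
    i<n = same-bound (Fin.toℕ<n i₀) same
    eq = Fin.toℕ-fromℕ< i<n

  -- `move?` may pick a coset other than the i-th; since both have the letter e, their gluing
  -- extends to the target.
  at-step : ∀ {s i h e} → At s i h → α i e → At (step e s) i (h ∷ʳ e)
  at-step {s} {e = e} a@(r , same) αe with move? e s
  ... | yes (j , same′ , αe′) = ++-congʳ [ e ] r , same-step αe′ αe (same-trans (same-sym same′) same)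
  ... | no ¬m = ⊥-elim (¬m (at⇒move a αe))

  step-involutive : ∀ e s → step e (step e s) ≈ s
  step-involutive e s@(i , h) = go (move? e s)
    where
    go : Dec (Move e s) → step e (step e s) ≈ s
    go (yes (j , same , αe)) = at-unique (at-step (at-step (~-refl , same) αe) αe) (~-refl , same)
      (~-trans (~-reflexive (++-assoc h [ e ] [ e ]))
        (~-trans (++-congˡ h (cancel e)) (~-reflexive (++-identityʳ h))))
    go (no ¬m) = subst (_≈ s) (sym (trans (cong (step e) (step-fixed ¬m)) (step-fixed ¬m))) ≈-refl

  step-cong : ∀ e {s t} → s ≈ t → step e s ≈ step e t
  step-cong e {s} {t} s≈t = go (move? e s) (move? e t)
    where
    go : Dec (Move e s) → Dec (Move e t) → step e s ≈ step e t
    go (yes (j , same , αe)) _ =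
      at-unique (at-step (~-refl , same) αe) (at-step (at-resp s≈t (~-refl , same)) αe) ~-refl
    go (no ¬m) (yes (j , same , αe)) = ⊥-elim (¬m (at⇒move (at-resp (≈-sym s≈t) (~-refl , same)) αe))
    go (no ¬m) (no ¬m′) =
      subst (_≈ step e t) (sym (step-fixed ¬m)) (subst (s ≈_) (sym (step-fixed ¬m′)) s≈t)

  -- The vertices that β-labelled paths from h in the i-th coset can reach: they lie on monotone
  -- paths (upwards for d = true) through the chain, as a backtracking path can be shortened
  -- because cosets intersect in cosets.
  module _ (β : Pred (Fin k) 0ℓ) (i : ℕ) (h : Word k) where

    Near : ℕ → Rel (Word k) 0ℓ
    Near j = Coset C (α j ∩ β)

    near-refl : ∀ {j u} → Near j u u
    near-refl {u = u} = [] , [] , ~-reflexive (sym (++-identityʳ u))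

    near-trans : ∀ {j u v w} → Near j u v → Near j v w → Near j u w
    near-trans {u = u} (x , px , r) (y , py , r′) =
      x ++ y , All.++⁺ px py , ~-trans r′ (~-trans (++-congʳ y r) (~-reflexive (++-assoc u x y)))

    Next : Bool → ℕ → ℕ → Set
    Next true  j l = l ≡ suc j
    Next false j l = j ≡ suc l

    data Path (d : Bool) : ℕ → Word k → Set where
      here  : ∀ {u} → Near i h u → Path d i u
      there : ∀ {j l u v} → Path d j u → Next d j l → Link j l u → Near l u v → Path d l v

    Reach : ℕ → Word k → Set
    Reach j u = ∃ λ d → Path d j u

    extend : ∀ {d j u v} → Path d j u → Near j u v → Path d j v
    extend (here c) c′ = here (near-trans c c′)
    extend (there p nx l c) c′ = there p nx l (near-trans c c′)

    shared : ∀ {j l u v} → Link j l u → Link l j v →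
      ∃ λ m → D m u × D m v × (∀ {e} → (α m ∩ α (suc m)) e → α j e)
    shared (inj₁ (refl , _ , d)) (inj₂ (refl , _ , d′)) = _ , d , d′ , proj₁
    shared (inj₂ (refl , _ , d)) (inj₁ (refl , _ , d′)) = _ , d , d′ , proj₂

    -- Both crossings use the same gluing set, so by `D-coset` the detour through coset l can be
    -- read in letters common to both cosets, hence inside coset j.
    retrace : ∀ {j l u v} → Link j l u → Link l j v → Near l u v → Near j u v
    retrace lu lv (x , px , r) with shared lu lv
    ... | m , du , dv , sub with D-coset du dv (x , px , r)
    ... | y , py , r′ = y , All.map (λ ((_ , βe) , c) → sub c , βe) py , r′

    -- A path without crossings can still choose its direction; turning back later cancels the last
    -- crossing by `retrace`.
    cross : ∀ {d j l u} → Path d j u → Link j l u → Reach l u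
    cross {true} p lk@(inj₁ (refl , _)) = true , there p refl lk near-refl
    cross {false} p lk@(inj₂ (refl , _)) = false , there p refl lk near-refl
    cross {true} (here c) lk@(inj₂ (refl , _)) = false , there (here c) refl lk near-refl
    cross {false} (here c) lk@(inj₁ (refl , _)) = true , there (here c) refl lk near-refl
    cross {true} (there p refl lk c) lk′@(inj₂ (refl , _)) = true , extend p (retrace lk lk′ c)
    cross {false} (there p refl lk c) lk′@(inj₁ (refl , _)) = false , extend p (retrace lk lk′ c)

    Ordered : Bool → ℕ → Set
    Ordered true  j = i ≤ j
    Ordered false j = j ≤ i

    path-ordered : ∀ {d j u} → Path d j u → Ordered d j
    path-ordered {true} (here _) = ≤-refl
    path-ordered {false} (here _) = ≤-refl
    path-ordered {true} (there p refl _ _) = m≤n⇒m≤1+n (path-ordered p)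
    path-ordered {false} (there p refl _ _) = <⇒≤ (path-ordered p)

    -- A monotone path that has left the i-th coset never returns to it.
    reach-near : ∀ {u} → Reach i u → Near i h u
    reach-near (_ , here c) = c
    reach-near (true , there p refl _ _) = ⊥-elim (1+n≰n (path-ordered p))
    reach-near (false , there p refl _ _) = ⊥-elim (1+n≰n (path-ordered p))

    reach-at : ∀ {j u l v} → Reach (toℕ j) u → At (j , u) l v → Reach l v
    reach-at {u = u} {v = v} (d , p) (r , same) = go same
      where
      near : ∀ {m} → Near m u v
      near = [] , [] , ~-trans (~-sym r) (~-reflexive (sym (++-identityʳ u)))
      go : Same (toℕ _) _ u → Reach _ v
      go (inj₁ refl) = d , extend p near
      go (inj₂ lk) with cross p lk
      ... | d′ , p′ = d′ , extend p′ near

    ReachState : State → Set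
    ReachState (j , u) = Reach (toℕ j) u

    reach-step : ∀ {e s} → β e → ReachState s → ReachState (step e s)
    reach-step {e} {s@(j , u)} βe reach = go (move? e s)
      where
      go : Dec (Move e s) → ReachState (step e s)
      go (no ¬m) = subst ReachState (sym (step-fixed ¬m)) reach
      go (yes (l , same , αe)) with reach-at {j = j} reach (~-refl , same)
      ... | d , p = reach-at {j = l} (d , extend p ([ e ] , (αe , βe) ∷ [] , ~-refl))
        (≈-sym {step e s} {l , u ∷ʳ e} (at-step {s} (~-refl , same) αe))

    reach-run : ∀ {w s} → All β w → ReachState s → ReachState (act step w s)
    reach-run [] reach = reach
    reach-run {e ∷ w} {s} (βe ∷ βw) reach = reach-run βw (reach-step {s = s} βe reach)

    thin : ∀ {w s u} → All β w → At s i h → At (act step w s) i u → Near i h u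
    thin {w} {s@(j , v)} βw a a′ = reach-near (reach-at (reach-run {s = s} βw start) a′)
      where
      near : ∀ {l} → Near l h v
      near = [] , [] , ~-trans (proj₁ a) (~-reflexive (sym (++-identityʳ h)))
      start : Reach (toℕ j) v
      start with same-sym (same-resp (proj₁ a) (proj₂ a))
      ... | inj₁ refl = true , here near
      ... | inj₂ lk with cross {true} (here near-refl) lk
      ...   | d , p = d , extend p near

  at-bound : ∀ {s i h} → At s i h → i < N
  at-bound {i , _} (_ , same) = ≤-trans (same-bound (Fin.toℕ<n i) same) n≤N

  graph : CosetGraph C N
  graph = record
    { State = State ; _≈_ = _≈_
    ; ≈-equiv = record
      { refl = λ {s} → ≈-refl {s}
      ; sym = λ {s} {t} → ≈-sym {s} {t}
      ; trans = λ {s} {t} {u} → ≈-trans {s} {t} {u} }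
    ; _≈?_ = λ (i , h) (j , h′) → (h ~? h′) ×-dec same? (toℕ i) (toℕ j) h
    ; step = step ; step-cong = λ e {s} {t} → step-cong e {s} {t} ; step-involutive = step-involutive
    ; piece = α ; piece? = α? ; At = At
    ; at-bound = λ {s} {i} {h} a → at-bound {s} {i} {h} a
    ; at-exists = λ (i , h) → toℕ i , h , ~-refl , inj₁ refl
    ; at-resp = λ {s} {t} {i} {h} → at-resp {s} {t} {i} {h}
    ; at-unique = λ {s} {t} {i} {h} {h′} → at-unique {s} {t} {i} {h} {h′}
    ; at-step = λ {s} {i} {h} {e} → at-step {s} {i} {h} {e}
    ; thin = λ {β} {w} {s} {i} {h} {h′} → thin β i h {w} {s} {h′} }

-- Retractions onto subgroups, and the absence of coset cycles

module Acyclicity {k N} (C : WordCongruence k) (_~?_ : Decidable (C ⊢_~_))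
  (1≤N : 1 ≤ N) (sat : ∀ j → j < k → SaturatedAt C N j) where

  open WordCongruence C

  module Retraction {γ : Pred (Fin k) 0ℓ} (γ? : U.Decidable γ) (proper : Fewer k γ) where

    module Single = Chain C _~?_ 1≤N (λ _ → γ) (λ _ → γ?) (λ _ _ → ⊥) (λ _ _ → no id)
      (λ _ → id) (λ glued _ _ → glued) (λ glued → ⊥-elim glued) (λ glued → ⊥-elim glued)

    -- In the graph of the single coset, the γ-part of a word leads from the identity to the element
    -- it spells, and relations hold there for γ-parts.
    retract : ∀ {u v} → u ~ v → filter γ? u ~ filter γ? v
    retract {u} {v} u~v =
      ~-trans (~-sym (proj₁ (arrive u)))
        (~-trans (proj₁ (relations-hold Single.graph sat k ≤-refl γ? o
            (λ _ _ → fewer-∩ proper) u~v))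
          (proj₁ (arrive v)))
      where
      o : Single.State
      o = Fin.zero , []
      arrive : ∀ w → Single.At (act Single.step (filter γ? w) o) 0 (filter γ? w)
      arrive w = CosetGraph.at-run Single.graph {filter γ? w} (~-refl , inj₁ refl) (All.all-filter γ? w)

    retract-fixed : ∀ {u x} → u ~ x → All γ x → filter γ? u ~ u
    retract-fixed u~x γx =
      ~-trans (retract u~x) (~-trans (~-reflexive (filter-all γ? γx)) (~-sym u~x))

    -- Membership of w means that the retraction fixes the quotient of q and w.
    coset? : ∀ q w → Dec (Coset C γ q w)
    coset? q w with (reverse q ++ w) ~? filter γ? (reverse q ++ w)
    ... | yes r = yes (filter γ? (reverse q ++ w) , All.all-filter γ? (reverse q ++ w) ,
                       ~-trans (~-sym (cancelˡ′ q w)) (++-congˡ q r))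
    ... | no ¬r = no λ (x , γx , r) → ¬r (~-sym (retract-fixed
                       (~-trans (++-congˡ (reverse q) r) (cancelˡ q x)) γx))

    -- The quotient of u and v lies in the subgroup of γ, so retracting its P-word does not change
    -- it and leaves only letters in both sets.
    coset-∩ : ∀ {P : Pred (Fin k) 0ℓ} {u v} → Coset C P u v → Coset C γ u v → Coset C (P ∩ γ) u v
    coset-∩ {u = u} (x , px , r) (y , γy , r′) =
      filter γ? x , All.zip (All.filter⁺ γ? px , All.all-filter γ? x) ,
      ~-trans r (++-congˡ u (~-sym (retract-fixed (~-cancelˡ u (~-trans (~-sym r) r′)) γy)))

  -- The cycle is unrolled along the natural numbers. Its label is a relation, so in the chain of
  -- its cosets it returns to the start, yet it ends in the last coset.
  no-cycle : ∀ {m} → 1 ≤ m → suc m ≤ N →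
    (g : ℕ → Word k) (α : ℕ → Pred (Fin k) 0ℓ) (α? : ∀ i → U.Decidable (α i)) →
    (∀ i → Fewer k (α i)) →
    (∀ i → Coset C (α i) (g i) (g (suc i))) →
    (∀ i {v} → Coset C (α i ∩ α (suc i)) (g (suc i)) v →
               ¬ Coset C (α (suc i) ∩ α (suc (suc i))) (g (suc (suc i))) v) →
    ¬ Coset C (α 0 ∩ α 1) (g 1) (g 0) →
    ¬ (g (suc m) ~ g 0)
  no-cycle {m} 1≤m m<N g α α? proper conn sep sep₀ closed = absurd
    where
    γ : ℕ → Pred (Fin k) 0ℓ
    γ i = α i ∩ α (suc i)

    γ? : ∀ i → U.Decidable (γ i)
    γ? i e = α? i e ×-dec α? (suc i) e

    module R i = Retraction (γ? i) (fewer-∩ (proper i))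

    -- Gluing along the overlap around `g (suc i)`; separation makes successive gluing sets
    -- disjoint.
    D : ℕ → Word k → Set
    D i = Coset C (γ i) (g (suc i))

    D-coset : ∀ {i u v} {P : Pred (Fin k) 0ℓ} → D i u → D i v → Coset C P u v → Coset C (P ∩ γ i) u v
    D-coset {i} {u} {v} (x , γx , r) (y , γy , r′) c = R.coset-∩ i c
      (reverse x ++ y , All.++⁺ (All-reverse γx) γy ,
       ~-trans r′ (~-trans (++-congʳ y (~-trans (~-sym (cancelʳ (g (suc i)) x)) (++-congʳ (reverse x) (~-sym r))))
         (~-reflexive (++-assoc u (reverse x) y))))

    open Chain C _~?_ m<N α α? D (λ i → R.coset? i (g (suc i)))
      (λ r (x , γx , r′) → x , γx , ~-trans (~-sym r) r′)
      (λ {i} {u} {e} (x , γx , r) αe αe′ → x ∷ʳ e , All.++⁺ γx ((αe , αe′) ∷ []) ,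
        ~-trans (++-congʳ [ e ] r) (~-reflexive (++-assoc (g (suc i)) x [ e ])))
      D-coset (sep _)

    segment : ℕ → Word k
    segment i = proj₁ (conn i)

    walk : ℕ → Word k
    walk zero = []
    walk (suc i) = walk i ++ segment i

    walk~ : ∀ i → g i ~ g 0 ++ walk i
    walk~ zero = ~-reflexive (sym (++-identityʳ (g 0)))
    walk~ (suc i) = ~-trans (proj₂ (proj₂ (conn i)))
      (~-trans (++-congʳ (segment i) (walk~ i)) (~-reflexive (++-assoc (g 0) (walk i) (segment i))))

    o : State
    o = Fin.zero , g 0

    leave : ∀ i → At (act step (walk i) o) i (g i) → At (act step (walk (suc i)) o) i (g (suc i))
    leave i a with CosetGraph.at-run graph {segment i} {act step (walk i) o} {i} {g i} a (proj₁ (proj₂ (conn i)))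
    ... | r , same = subst (λ s → At s i (g (suc i))) (sym (act-++ step (walk i) (segment i) o))
                       (~-trans r (~-sym (proj₂ (proj₂ (conn i)))) , same)

    arrive : ∀ i → i < suc m → At (act step (walk i) o) i (g i)
    arrive zero _ = ~-refl , inj₁ refl
    arrive (suc i) lt with leave i (arrive i (<⇒≤ lt))
    ... | r , same = r , same-trans same (inj₂ (inj₁ (refl , lt ,
                       ([] , [] , ~-trans r (~-reflexive (sym (++-identityʳ (g (suc i)))))))))

    returns : act step (walk (suc m)) o ≈ o
    returns = subst (λ w → act step w o ≈ o) (filter-all all? (All.universal (λ _ → tt) (walk (suc m))))
      (relations-hold graph sat k ≤-refl all? o
        (λ {_} {i} _ _ → fewer-∩ (proper i))
        {walk (suc m)} {[]}
        (~-cancelˡ (g 0) (~-trans (~-sym (walk~ (suc m))) (~-trans closed (~-reflexive (sym (++-identityʳ (g 0))))))))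
      where
      all? : U.Decidable {A = Fin k} (λ _ → ⊤)
      all? _ = yes tt

    absurd : ⊥
    absurd with at-resp {act step (walk (suc m)) o} {o} returns (leave m (arrive m ≤-refl))
    -- Now `g 0` lies in the first and in the last coset. These are distinct, and linked only if m
    -- is 1, when `sep₀` forbids gluing at `g 0`.
    ... | _ , inj₁ refl = 1+n≰n 1≤m
    ... | _ , inj₂ (inj₁ (refl , _ , d)) = sep₀ d

-- Decidability up to double negation, and cyclic indices

module _ {k} (C : WordCongruence k) where

  open WordCongruence C

  -- It suffices to know which of the finitely many class names are borne by a trivial word.
  ¬¬-decidable : ¬ ¬ Decidable _~_
  ¬¬-decidable ¬dec = ¬¬-Π (λ c → ¬¬-excluded-middle {A = ∃ λ w → class w ≡ c × w ~ []}) λ trivial? →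
    ¬dec λ u v → decide u v (trivial? (class (reverse u ++ v)))
    where
    decide : ∀ u v → Dec (∃ λ w → class w ≡ class (reverse u ++ v) × w ~ []) → Dec (u ~ v)
    decide u v (yes (w , eq , r)) = yes (~-sym (~-trans (~-sym (cancelˡ′ u v))
      (~-trans (++-congˡ u (~-trans (~-sym (class-reflects eq)) r)) (~-reflexive (++-identityʳ u)))))
    decide u v (no ¬p) = no λ r → ¬p (reverse u ++ v , refl ,
      ~-trans (++-congˡ (reverse u) (~-sym r)) (inverseˡ~ u))

module _ {n} .{{_ : NonZero n}} where

  mod-cong : ∀ {a b} → a % n ≡ b % n → a mod n ≡ b mod n
  mod-cong {a} {b} eq = Fin.fromℕ<-cong _ _ eq (m%n<n a n) (m%n<n b n)

  toℕ-mod : ∀ a → toℕ (a mod n) ≡ a % n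
  toℕ-mod a = Fin.toℕ-fromℕ< (m%n<n a n)

  %-absorbˡ : ∀ a b → (a % n + b) % n ≡ (a + b) % n
  %-absorbˡ a b = trans (%-distribˡ-+ (a % n) b n)
    (trans (cong (λ x → (x + b % n) % n) (m%n%n≡m%n a n)) (sym (%-distribˡ-+ a b n)))

  next-mod : ∀ i → next (i mod n) ≡ suc i mod n
  next-mod i = mod-cong (begin
    suc (toℕ (i mod n)) % n ≡⟨ cong (_% n) (+-comm 1 (toℕ (i mod n))) ⟩
    (toℕ (i mod n) + 1) % n ≡⟨ cong (λ x → (x + 1) % n) (toℕ-mod i) ⟩
    (i % n + 1) % n         ≡⟨ %-absorbˡ i 1 ⟩
    (i + 1) % n             ≡⟨ cong (_% n) (+-comm i 1) ⟩
    suc i % n               ∎)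
    where open ≡-Reasoning

  prev-mod : ∀ i → prev (suc i mod n) ≡ i mod n
  prev-mod i = mod-cong (begin
    (toℕ (suc i mod n) + (n ∸ 1)) % n ≡⟨ cong (λ x → (x + (n ∸ 1)) % n) (toℕ-mod (suc i)) ⟩
    (suc i % n + (n ∸ 1)) % n         ≡⟨ %-absorbˡ (suc i) (n ∸ 1) ⟩
    (suc i + (n ∸ 1)) % n             ≡⟨ cong (_% n) (sym (+-suc i (n ∸ 1))) ⟩
    (i + suc (n ∸ 1)) % n             ≡⟨ cong (λ x → (i + x) % n) (suc-pred n) ⟩
    (i + n) % n                       ≡⟨ [m+n]%n≡m%n i n ⟩
    i % n                             ∎)
    where open ≡-Reasoning

  mod-periodic : ∀ i → (i + n) mod n ≡ i mod n
  mod-periodic i = mod-cong ([m+n]%n≡m%n i n)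

-- Coset cycles in the presented group

module _ {k N} (G : EGroup k) (C : WordCongruence k)
  (toG : ∀ u v → C ⊢ u ~ v → G ⊨ u ≈ v)
  (1≤N : 1 ≤ N) (sat : ∀ j → j < k → SaturatedAt C N j) where

  open WordCongruence C

  private
    Ĝ : EGroup k
    Ĝ = Presented.presented G C toG

    toCoset : ∀ {α q w} → InCoset Ĝ q α w → Coset C (S._∈ α) q w
    toCoset {q = q} (x , αx , r) = x , αx , ~-trans r (~-reflexive (cong (q ++_) (evalWord-letters x)))

    fromCoset : ∀ {α q w} → Coset C (S._∈ α) q w → InCoset Ĝ q α w
    fromCoset {q = q} (x , αx , r) = x , αx , ~-trans r (~-reflexive (cong (q ++_) (sym (evalWord-letters x))))

  presented-acyclic : Acyclic Ĝ N
  presented-acyclic (suc m) (s≤s 1≤m) m<N cycle = ¬¬-decidable C λ _~?_ →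
    Acyclicity.no-cycle C _~?_ 1≤N sat 1≤m m<N
      -- Starting at index 2 leaves room for the two preceding indices that `proper` refers to.
      (λ i → g (2 + i)) (λ i → S._∈ α (2 + i)) (λ i e → e S.∈? α (2 + i))
      (λ i → proper i) (λ i → conn (2 + i))
      (λ i {v} c c′ → sep (2 + i) (Coset-map (λ (a , b) → b , a) c) c′)
      (λ c → sep 1 refl-coset c)
      (~-reflexive (cong Cyc.g (mod-periodic 2)))
    where
    module Cyc = CosetCycle cycle

    g : ℕ → Word k
    g i = Cyc.g (i mod suc m)

    α : ℕ → S.Subset k
    α i = Cyc.α (i mod suc m)

    Coset-map : ∀ {P Q : Pred (Fin k) 0ℓ} {q w} → (∀ {e} → P e → Q e) → Coset C P q w → Coset C Q q w
    Coset-map f (x , px , r) = x , All.map f px , r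

    refl-coset : ∀ {P : Pred (Fin k) 0ℓ} {q} → Coset C P q q
    refl-coset {q = q} = [] , [] , ~-reflexive (sym (++-identityʳ q))

    conn : ∀ i → Coset C (S._∈ α i) (g i) (g (suc i))
    conn i = subst (λ j → Coset C (S._∈ α i) (g i) (Cyc.g j)) (next-mod i)
      (toCoset (Cyc.connectivity (i mod suc m)))

    sep : ∀ i {v} → Coset C ((S._∈ α (suc i)) ∩ (S._∈ α i)) (g (suc i)) v →
      ¬ Coset C ((S._∈ α (suc i)) ∩ (S._∈ α (suc (suc i)))) (g (suc (suc i))) v
    sep i {v} c c′ = Cyc.separation (suc i mod suc m) (v ,
      subst (λ j → InCoset Ĝ (g (suc i)) (α (suc i) S.∩ Cyc.α j) v) (sym (prev-mod i))
        (fromCoset (Coset-map S.x∈p∩q⁺ c)) ,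
      subst (λ j → InCoset Ĝ (Cyc.g j) (α (suc i) S.∩ Cyc.α j) v) (sym (next-mod (suc i)))
        (fromCoset (Coset-map S.x∈p∩q⁺ c′)))

    -- If all letters were available, the word x connecting the preceding coset to this one would
    -- put `g (suc i)` into both sets that separation at `suc i` keeps disjoint.
    proper : ∀ i → Fewer k (S._∈ α (2 + i))
    proper i with All.all? (S._∈? α (2 + i)) (allFin k)
    ... | no ¬all = filter (S._∈? α (2 + i)) (allFin k)
                  , subst (length (filter (S._∈? α (2 + i)) (allFin k)) <_) (length-tabulate id)
                      (filter-notAll _ (allFin k) (All.¬All⇒Any¬ (S._∈? α (2 + i)) (allFin k) ¬all))
                  , λ {e} e∈ → ∈-filter⁺ (S._∈? α (2 + i)) (∈-allFin e) e∈
    ... | yes all with conn (suc i)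
    ...   | x , αx , r = ⊥-elim (sep i refl-coset
            (reverse x , All-reverse (All.map (λ {e} e∈ → e∈ , All.lookup all (∈-allFin e)) αx) ,
             ~-trans (~-sym (cancelʳ (g (suc i)) x)) (++-congʳ (reverse x) (~-sym r))))

-- The word problem of G, its symmetries, and the theorem

module _ {k} (G : EGroup k) where
  private
    module G = EGroup G

  wordProblem : IsFinite G → WordCongruence k
  wordProblem (n , f , onto) = record
    { _~_ = G ⊨_≈_
    ; isEquivalence = record { refl = G.refl ; sym = G.sym ; trans = G.trans }
    ; ++-cong = λ {u} {u′} {v} {v′} r s →
        G.trans (eval-++ G u v) (G.trans (G.∙-cong r s) (G.sym (eval-++ G u′ v′)))
    ; cancel = λ e → G.trans (G.∙-congˡ (G.identityʳ _)) (G.involution e)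
    ; index = n
    ; class = λ w → proj₁ (onto G.⟦ w ⟧)
    ; class-reflects = λ {u} {v} eq → G.trans (G.sym (proj₂ (onto G.⟦ u ⟧)))
        (G.trans (G.reflexive (cong f eq)) (proj₂ (onto G.⟦ v ⟧))) }

  module _ {ρ : Permutation′ k} (symmetry : IsSymmetry ρ G) where

    open GroupMorphisms.IsGroupIsomorphism (proj₁ (proj₂ symmetry))

    private
      φ : G.Carrier → G.Carrier
      φ = proj₁ symmetry

    symmetry-eval : ∀ w → φ G.⟦ w ⟧ G.≈ G.⟦ map (ρ ⟨$⟩ʳ_) w ⟧
    symmetry-eval [] = ε-homo
    symmetry-eval (e ∷ w) = G.trans (∙-homo _ _) (G.∙-cong (proj₂ (proj₂ symmetry) e) (symmetry-eval w))

    symmetry-mapʳ : ∀ {u v} → G ⊨ u ≈ v → G ⊨ map (ρ ⟨$⟩ʳ_) u ≈ map (ρ ⟨$⟩ʳ_) v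
    symmetry-mapʳ {u} {v} r = G.trans (G.sym (symmetry-eval u)) (G.trans (⟦⟧-cong r) (symmetry-eval v))

    -- The automorphism undoes the inverse renaming, so its injectivity gives the claim.
    symmetry-mapˡ : ∀ {u v} → G ⊨ u ≈ v → G ⊨ map (ρ ⟨$⟩ˡ_) u ≈ map (ρ ⟨$⟩ˡ_) v
    symmetry-mapˡ {u} {v} r = injective (G.trans (back u) (G.trans r (G.sym (back v))))
      where
      back : ∀ w → φ G.⟦ map (ρ ⟨$⟩ˡ_) w ⟧ G.≈ G.⟦ w ⟧
      back w = G.trans (symmetry-eval (map (ρ ⟨$⟩ˡ_) w))
        (G.reflexive (cong G.⟦_⟧ (map-inverse {f = ρ ⟨$⟩ʳ_} (λ _ → inverseʳ ρ) w)))

theorem5p3 : (k : ℕ) (G : EGroup k) → IsFinite G → (N : ℕ) → 2 ≤ N →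
    Σ (EGroup k) λ Ĝ → IsFinite Ĝ × (Ĝ ⪰ G) × Acyclic Ĝ N
    × ((ρ : Permutation′ k) → IsSymmetry ρ G → IsSymmetry ρ Ĝ)
theorem5p3 k G finite N 2≤N =
  presented , presented-finite , presented-⪰ ,
  presented-acyclic G (tower k) toG (<⇒≤ 2≤N) (tower-saturated C N) ,
  λ ρ symmetry → presented-symmetry ρ
    (λ {u} {v} → tower-map (ρ ⟨$⟩ʳ_) (λ {u} {v} → symmetry-mapʳ G {ρ} symmetry {u} {v}) k {u} {v})
    (λ {u} {v} → tower-map (ρ ⟨$⟩ˡ_) (λ {u} {v} → symmetry-mapˡ G {ρ} symmetry {u} {v}) k {u} {v})
  where
  C : WordCongruence k
  C = wordProblem G finite
  open Tower C N
  toG : ∀ u v → u ~[ k ] v → G ⊨ u ≈ v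
  toG u v = coarsen {j = k} {u} {v} (≤⇒≤′ z≤n)
  open Presented G (tower k) toG
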